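{- For every integer $n\ge 1$ there is a bipartite cubic graph of order $4n+2$ with exactly $2^n$ edge-Kempe equivalence classes of $3$-edge-colorings.
   Context: Graphs are finite, simple and undirected; the order of a graph is its number of vertices, and a cubic graph is a $3$-regular graph. A $3$-edge-coloring of a cubic graph is a partition of its edge set into $3$ (unlabeled) color classes such that no two adjacent edges are in the same class. Given a $3$-edge-coloring of a cubic graph, the union of any two of its color classes is a disjoint union of cycles of even length, whose edges alternate between the two colors; an edge-Kempe switch interchanges the two colors along one such cycle, yielding another $3$-edge-coloring. Two $3$-edge-colorings of the same graph are edge-Kempe equivalent if one can be obtained from the other by a (possibly empty) finite sequence of edge-Kempe switches; the equivalence classes of this relation are the edge-Kempe equivalence classes (automorphisms of the graph are not used to identify colorings). -}

module Defs where

open import Level using (0ℓ)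
open import Data.Bool using (Bool)
open import Data.Nat using (ℕ; suc; _+_)
open import Data.Nat.DivMod using (_mod_)
open import Data.Fin using (Fin; toℕ)
open import Data.Fin.Properties using (_≟_)
open import Data.Fin.Permutation.Components using (transpose; transpose-inverse)
open import Data.Product using (Σ-syntax; ∃-syntax; _×_; _,_)
open import Data.Sum using (_⊎_; inj₁; inj₂; map)
open import Function using (_∘_)
open import Function.Bundles using (_↔_; _⇔_; Bijection)
open import Function.Definitions using (Injective)
import Function.Properties.Equivalence as Equiv
open import Relation.Binary using (Rel; Setoid; Symmetric; Irreflexive; Irrelevant; Decidable)
open import Relation.Binary.Construct.Closure.ReflexiveTransitive using (Star; ε; _◅◅_; reverse)
open import Relation.Binary.PropositionalEquality using (_≡_; _≢_; refl; sym; trans; cong; setoid)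
open import Relation.Nullary using (¬_; yes; no; contradiction)

record Graph : Set₁ where
  field
    V              : Set
    order          : ℕ
    enumeration    : V ↔ Fin order
    Adj            : Rel V 0ℓ
    adj?           : Decidable Adj
    Adj-irrelevant : Irrelevant Adj        -- no parallel edges
    Adj-sym        : Symmetric Adj
    Adj-irrefl     : Irreflexive _≡_ Adj   -- no loops

Regular : ℕ → Graph → Set
Regular k G = ∀ v → (∃[ u ] Adj v u) ↔ Fin k
  where open Graph G

Cubic : Graph → Set
Cubic = Regular 3

Bipartite : Graph → Set
Bipartite G = Σ[ side ∈ (V → Bool) ] (∀ {u v} → Adj u v → side u ≢ side v)
  where open Graph G

-- The cyclic successor i ↦ i + 1 mod (suc m).
next : ∀ {m} → Fin (suc m) → Fin (suc m)
next {m} i = suc (toℕ i) mod suc m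

module _ (G : Graph) where
  open Graph G

  -- A cycle v₀ v₁ … v₍₂₊ₘ₎ v₀ in G, of length 3 + m.
  record Cycle : Set where
    field
      m        : ℕ
      vertex   : Fin (3 + m) → V
      distinct : Injective _≡_ _≡_ vertex
      adjacent : ∀ i → Adj (vertex i) (vertex (next i))

  -- The edge {u , v} is one of the edges of the cycle, in either orientation.
  OnCycle : Cycle → Rel V 0ℓ
  OnCycle C u v = ∃[ i ] ((u ≡ vertex i × v ≡ vertex (next i)) ⊎
                          (v ≡ vertex i × u ≡ vertex (next i)))
    where open Cycle C

  -- Colorings carry labels here; they are compared only through _≈_ and _∼_
  -- below, which do not see the labels.  In a cubic graph with at least one
  -- vertex all three labels are used.
  record Coloring : Set where
    field
      color     : ∀ {u v} → Adj u v → Fin 3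
      color-sym : ∀ {u v} (e : Adj u v) (e′ : Adj v u) → color e ≡ color e′
      proper    : ∀ {u v w} (e : Adj u v) (f : Adj u w) → v ≢ w → color e ≢ color f

  open Coloring

  -- Equality of unlabeled colorings: both induce the same partition of the edges.
  _≈_ : Rel Coloring 0ℓ
  c ≈ d = ∀ {u v x y} (e : Adj u v) (f : Adj x y) →
          (color c e ≡ color c f) ⇔ (color d e ≡ color d f)

  -- A cycle of G all of whose edges are colored a or b.  By properness its colors
  -- alternate, and it is one of the cycles making up the union of classes a and b.
  KempeCycle : Coloring → Fin 3 → Fin 3 → Cycle → Set
  KempeCycle c a b C = ∀ i → color c (adjacent i) ≡ a ⊎ color c (adjacent i) ≡ b
    where open Cycle C

  record Switch (c d : Coloring) : Set where
    field
      a b     : Fin 3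
      a≢b     : a ≢ b
      C       : Cycle
      isKempe : KempeCycle c a b C
      on      : ∀ {u v} (e : Adj u v) → OnCycle C u v → color d e ≡ transpose a b (color c e)
      off     : ∀ {u v} (e : Adj u v) → ¬ OnCycle C u v → color d e ≡ color c e

  -- A step replaces the labeling of a partition by another one, or is a Kempe switch.
  Step : Rel Coloring 0ℓ
  Step c d = (c ≈ d) ⊎ Switch c d

  _∼_ : Rel Coloring 0ℓ
  _∼_ = Star Step

  private
    transpose-∈ : ∀ {n} (a b x : Fin n) → x ≡ a ⊎ x ≡ b →
                  transpose a b x ≡ b ⊎ transpose a b x ≡ a
    transpose-∈ a b x x∈ with x ≟ a
    ... | yes _ = inj₁ refl
    ... | no x≢a with x ≟ b | x∈
    ...   | yes _  | _        = inj₂ refl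
    ...   | no _   | inj₁ x≡a = contradiction x≡a x≢a
    ...   | no x≢b | inj₂ x≡b = contradiction x≡b x≢b

    Switch-sym : Symmetric Switch
    Switch-sym {c} {d} s = record
      { a = b ; b = a ; a≢b = a≢b ∘ sym ; C = C
      ; isKempe = λ i → map (trans (on-C i)) (trans (on-C i))
                           (transpose-∈ a b (color c (adjacent i)) (isKempe i))
      ; on  = λ e o → trans (sym (transpose-inverse b a)) (cong (transpose b a) (sym (on e o)))
      ; off = λ e o → sym (off e o)
      }
      where
        open Switch s
        open Cycle C
        on-C : ∀ i → color d (adjacent i) ≡ transpose a b (color c (adjacent i))
        on-C i = on (adjacent i) (i , inj₁ (refl , refl))

    Step-sym : Symmetric Step
    Step-sym (inj₁ p) = inj₁ λ e f → Equiv.sym (p e f)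
    Step-sym (inj₂ s) = inj₂ (Switch-sym s)

  kempeSetoid : Setoid 0ℓ 0ℓ
  kempeSetoid = record
    { Carrier       = Coloring
    ; _≈_           = _∼_
    ; isEquivalence = record { refl = ε ; sym = reverse Step-sym ; trans = _◅◅_ }
    }

  HasKempeClasses : ℕ → Set
  HasKempeClasses k = Bijection (setoid (Fin k)) kempeSetoid

{-# OPTIONS --safe #-}
module Submission where

-- The graph is a ladder with three rails and n levels: level i has a site on
-- each rail and an apex joined to its three sites, and the rails end in the
-- two further vertices left and right.  (It is an iterated star product of n
-- copies of K₃,₃.)  Passing a level permutes the colors on the rails by one of
-- the two cyclic shifts, and the spokes get the other shift, so a coloring is
-- given by its colors at left and one sign per level, and as an unlabeled
-- coloring by the n signs alone.  Any two color classes form a connected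
-- subgraph, since this holds at left and persists across each level.  Hence a
-- Kempe switch only relabels the coloring, and the classes are the 2ⁿ sign vectors.

open import Defs
open import Axiom.UniquenessOfIdentityProofs using (module Decidable⇒UIP)
open import Data.Bool using (Bool; true; not)
open import Data.Bool.Properties using (not-¬; not-involutive)
open import Data.Fin
  using (Fin; zero; suc; toℕ; fromℕ; inject₁; punchIn; punchOut; finToFun; funToFin; combine)
open import Data.Fin.Induction using (<-weakInduction)
open import Data.Fin.Patterns using (0F; 1F; 2F)
open import Data.Fin.Permutation.Components using (transpose; transpose-inverse)
open import Data.Fin.Properties
  using ( _≟_; all?; any?; 0≢1+n; suc-injective; toℕ-injective; toℕ-fromℕ; toℕ-fromℕ<
        ; toℕ-inject₁; toℕ<n; +↔⊎; *↔×; punchIn-injective; punchInᵢ≢i; punchOut-injective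
        ; injective⇒≤; finToFun-funToFin; funToFin-finToFin)
open import Data.Fin.Relation.Unary.Top using (View; view; view-fromℕ; view-inject₁; ‵fromℕ; ‵inject₁)
open import Data.Nat using (ℕ; zero; suc; _+_; _*_; _^_; _%_; _≥_; s<s)
open import Data.Nat.DivMod using (_mod_; m<n⇒m%n≡m; n%n≡0)
open import Data.Nat.Properties using (1+n≰n; m≢1+n+m; +-cancelʳ-≡)
open import Data.Product using (Σ-syntax; ∃-syntax; _×_; _,_; proj₁; proj₂)
open import Data.Sum using (_⊎_; inj₁; inj₂; swap)
open import Data.Sum.Function.Propositional using (_⊎-↔_)
open import Function using (_∘_)
open import Function.Bundles using (_↔_; _⇔_; mk⇔; mk↔ₛ′; Equivalence)
open import Function.Definitions using (Injective)
import Function.Properties.Equivalence as Equiv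
open import Function.Properties.Inverse using (↔⇒↣; ↔-refl; ↔-sym; ↔-trans)
open import Relation.Binary using (DecidableEquality)
open import Relation.Binary.Construct.Closure.ReflexiveTransitive using (ε; _◅_)
open import Relation.Binary.PropositionalEquality
  using (_≡_; _≢_; refl; sym; trans; cong; cong₂; subst; module ≡-Reasoning)
open import Relation.Nullary using (¬_; Dec; yes; no; contradiction)
open import Relation.Nullary.Decidable
  using (_⊎-dec_; _×-dec_; _→-dec_; ¬?; from-yes; via-injection)

-- The cyclic successor

next-inject₁ : ∀ {m} (i : Fin m) → next (inject₁ i) ≡ suc i
next-inject₁ {m} i = toℕ-injective (trans (toℕ-fromℕ< _) (trans
  (cong (λ k → suc k % suc m) (toℕ-inject₁ i)) (m<n⇒m%n≡m (s<s (toℕ<n i)))))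

next-fromℕ : ∀ m → next (fromℕ m) ≡ zero
next-fromℕ m = toℕ-injective (trans (toℕ-fromℕ< _) (trans
  (cong (λ k → suc k % suc m) (toℕ-fromℕ m)) (n%n≡0 (suc m))))

next-surjective : ∀ {m} (i : Fin (suc m)) → ∃[ j ] next j ≡ i
next-surjective zero    = fromℕ _ , next-fromℕ _
next-surjective (suc i) = inject₁ i , next-inject₁ i

-- Used to see that the two cycle edges at a vertex have different far ends, hence different colors.
next²≢id : ∀ {m} (i : Fin (3 + m)) → next (next i) ≢ i
next²≢id i eq with view i
... | ‵fromℕ with () ← trans (sym (cong next (next-fromℕ _))) eq
... | ‵inject₁ j = no-return j (view (suc j)) refl (trans (sym (cong next (next-inject₁ j))) eq)
  where
  no-return : ∀ {m k} (j : Fin (2 + m)) → View k → k ≡ suc j → next k ≢ inject₁ j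
  -- Length at least 3 enters here: `suc zero` is not the top element, so only a nonzero `j` could
  -- wrap around, and then `zero` is not `inject₁ j`.
  no-return zero    ‵fromℕ       ()
  no-return (suc j) ‵fromℕ       _ q with () ← trans (sym (next-fromℕ _)) q
  no-return j       (‵inject₁ k) p q = m≢1+n+m (toℕ j) {1} (begin
    toℕ j                 ≡⟨ toℕ-inject₁ j ⟨
    toℕ (inject₁ j)       ≡⟨ cong toℕ (trans (sym (next-inject₁ k)) q) ⟨
    suc (toℕ k)           ≡⟨ cong suc (toℕ-inject₁ k) ⟨
    suc (toℕ (inject₁ k)) ≡⟨ cong (suc ∘ toℕ) p ⟩
    2 + toℕ j             ∎)
    where open ≡-Reasoning

-- Pairs of colors and transpositions

_∈[_,_] : Fin 3 → Fin 3 → Fin 3 → Set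
x ∈[ a , b ] = x ≡ a ⊎ x ≡ b

transpose-injective : ∀ {n} (a b : Fin n) {x y} → transpose a b x ≡ transpose a b y → x ≡ y
transpose-injective a b eq =
  trans (sym (transpose-inverse b a)) (trans (cong (transpose b a) eq) (transpose-inverse b a))

transpose-fixes : ∀ {a b x} → ¬ x ∈[ a , b ] → transpose a b x ≡ x
transpose-fixes {a} {b} {x} x∉ with x ≟ a
... | yes x≡a = contradiction (inj₁ x≡a) x∉
... | no  _ with x ≟ b
...   | yes x≡b = contradiction (inj₂ x≡b) x∉
...   | no  _   = refl

-- Dart systems and their colorings

-- A bipartite cubic graph presented by its darts (v , k), the k-th half-edge
-- at v, and the involution exchanging the two halves of each edge.
record DartSystem : Set₁ where
  field
    V               : Set
    order           : ℕ
    enumeration     : V ↔ Fin order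
    twin            : V × Fin 3 → V × Fin 3
    twin-involutive : ∀ d → twin (twin d) ≡ d
    simple          : ∀ {v k l} → proj₁ (twin (v , k)) ≡ proj₁ (twin (v , l)) → k ≡ l
    side            : V → Bool
    side-twin       : ∀ d → side (proj₁ (twin d)) ≡ not (side (proj₁ d))

  Dart : Set
  Dart = V × Fin 3

  Adj : V → V → Set
  Adj u v = ∃[ k ] proj₁ (twin (u , k)) ≡ v

  dart : ∀ {u v} → Adj u v → Dart
  dart {u} (k , _) = u , k

  edge : (d : Dart) → Adj (proj₁ d) (proj₁ (twin d))
  edge (v , k) = k , refl

  _≟V_ : DecidableEquality V
  _≟V_ = via-injection (↔⇒↣ enumeration) _≟_

  Adj-sym : ∀ {u v} → Adj u v → Adj v u
  Adj-sym {u} (k , refl) = proj₂ (twin (u , k)) , cong proj₁ (twin-involutive (u , k))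

  Adj-unique : ∀ {u v} (e f : Adj u v) → e ≡ f
  Adj-unique (k , p) (l , q) with refl ← simple (trans p (sym q)) =
    cong (k ,_) (Decidable⇒UIP.≡-irrelevant _≟V_ p q)

  Adj-side : ∀ {u v} → Adj u v → side u ≢ side v
  Adj-side {u} (k , refl) eq = not-¬ (sym eq) (side-twin (u , k))

  graph : Graph
  graph = record
    { V              = V
    ; order          = order
    ; enumeration    = enumeration
    ; Adj            = Adj
    ; adj?           = λ u v → any? λ k → proj₁ (twin (u , k)) ≟V v
    ; Adj-irrelevant = Adj-unique
    ; Adj-sym        = Adj-sym
    ; Adj-irrefl     = λ { refl e → Adj-side e refl }
    }

  cubic : Cubic graph
  cubic v = mk↔ₛ′ (λ (_ , k , _) → k) (λ k → _ , edge (v , k))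
                  (λ _ → refl) (λ { (_ , _ , refl) → refl })

  bipartite : Bipartite graph
  bipartite = side , Adj-side

  twin-dart : ∀ {u v} (e : Adj u v) (e′ : Adj v u) → twin (dart e) ≡ dart e′
  twin-dart e@(_ , refl) e′ = cong dart (Adj-unique (Adj-sym e) e′)

  record DartColoring : Set where
    field
      col           : Dart → Fin 3
      col-twin      : ∀ d → col (twin d) ≡ col d
      col-injective : ∀ {v k l} → col (v , k) ≡ col (v , l) → k ≡ l

  open DartColoring
  open Coloring

  toColoring : DartColoring → Coloring graph
  toColoring γ = record
    { color     = col γ ∘ dart
    ; color-sym = λ e e′ → trans (sym (col-twin γ (dart e))) (cong (col γ) (twin-dart e e′))
    ; proper    = λ { {u} (k , refl) (l , refl) v≢w eq →
                      v≢w (cong (proj₁ ∘ twin ∘ (u ,_)) (col-injective γ eq)) }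
    }

  color-dart : ∀ (c : Coloring graph) {u v} (e : Adj u v) → color c e ≡ color c (edge (dart e))
  color-dart c (_ , refl) = refl

  fromColoring : Coloring graph → DartColoring
  fromColoring c = record
    { col           = color c ∘ edge
    ; col-twin      = λ d → trans (sym (color-dart c (Adj-sym (edge d))))
                                  (color-sym c (Adj-sym (edge d)) (edge d))
    ; col-injective = injective
    }
    where
    injective : ∀ {v k l} → color c (edge (v , k)) ≡ color c (edge (v , l)) → k ≡ l
    injective {v} {k} {l} eq with k ≟ l
    ... | yes k≡l = k≡l
    ... | no  k≢l = contradiction eq (proper c (edge (v , k)) (edge (v , l)) (k≢l ∘ simple))

  _≈ᵍ_ _∼ᵍ_ : Coloring graph → Coloring graph → Set
  _≈ᵍ_ = _≈_ graph
  _∼ᵍ_ = _∼_ graph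

  recolored⇒≈ : ∀ {γ c} {π : Fin 3 → Fin 3} → Injective _≡_ _≡_ π →
                (∀ d → col (fromColoring c) d ≡ π (col γ d)) → toColoring γ ≈ᵍ c
  recolored⇒≈ {γ} {c} {π} π-injective recolored e f = mk⇔
    (λ eq → trans (recolored′ e) (trans (cong π eq) (sym (recolored′ f))))
    (λ eq → π-injective (trans (sym (recolored′ e)) (trans eq (recolored′ f))))
    where
    recolored′ : ∀ {u v} (e : Adj u v) → color c e ≡ π (color (toColoring γ) e)
    recolored′ e = trans (color-dart c e) (recolored (dart e))

  -- Kempe switches under connectivity

  -- P contains, with a dart, the rest of its component in the subgraph of
  -- the edges colored a or b.
  record Saturated (γ : DartColoring) (a b : Fin 3) (P : Dart → Set) : Set where
    field
      colored   : ∀ {d} → P d → col γ d ∈[ a , b ]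
      at-twin   : ∀ {d} → P d → P (twin d)
      at-vertex : ∀ {v k} l → P (v , k) → col γ (v , l) ∈[ a , b ] → P (v , l)

  -- Connectivity is phrased by predicates instead of paths, so that it applies directly to the set
  -- of darts on a Kempe cycle.
  KempeConnected : DartColoring → Set₁
  KempeConnected γ = ∀ {a b P} → a ≢ b → Saturated γ a b P →
    ∀ {d d′} → P d → col γ d′ ∈[ a , b ] → P d′

  color-injective : ∀ (c : Coloring graph) {u v w} (e : Adj u v) (f : Adj u w) →
                    color c e ≡ color c f → v ≡ w
  color-injective c {u} (k , refl) (l , refl) eq =
    cong (proj₁ ∘ twin ∘ (u ,_)) (col-injective (fromColoring c) eq)

  module _ (c : Coloring graph) {a b} (C : Cycle graph) (isKempe : KempeCycle graph c a b C) where
    open Cycle C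

    OnDart : Dart → Set
    OnDart d = OnCycle graph C (proj₁ d) (proj₁ (twin d))

    on-colored : ∀ {u v} (e : Adj u v) → OnCycle graph C u v → color c e ∈[ a , b ]
    on-colored e (i , inj₁ (refl , refl)) =
      subst (λ e → color c e ∈[ a , b ]) (Adj-unique (adjacent i) e) (isKempe i)
    on-colored e (i , inj₂ (refl , refl)) =
      subst (_∈[ a , b ]) (color-sym c (adjacent i) e) (isKempe i)

    -- The two cycle edges at a vertex differ in color, so they exhaust `a` and `b`; by properness a
    -- dart there with one of these colors lies on one of them.
    on-vertex : ∀ i l → color c (edge (vertex i , l)) ∈[ a , b ] → OnDart (vertex i , l)
    -- Writing `i` as a successor gives access to the incoming cycle edge besides the outgoing one.
    on-vertex i l l∈ with j , refl ← next-surjective i =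
      choose (onePair (isKempe (next j)) (on-colored e₀ (j , inj₂ (refl , refl))) l∈
                (proper c (adjacent (next j)) e₀ (next²≢id j ∘ distinct)))
      where
      e₀ : Adj (vertex (next j)) (vertex j)
      e₀ = Adj-sym (adjacent j)

      onePair : ∀ {x y z} → x ∈[ a , b ] → y ∈[ a , b ] → z ∈[ a , b ] → x ≢ y → z ≡ x ⊎ z ≡ y
      onePair (inj₁ refl) (inj₁ refl) _ x≢y = contradiction refl x≢y
      onePair (inj₁ refl) (inj₂ refl) z∈ _  = z∈
      onePair (inj₂ refl) (inj₁ refl) z∈ _  = swap z∈
      onePair (inj₂ refl) (inj₂ refl) _ x≢y = contradiction refl x≢y

      eₗ : Adj (vertex (next j)) _
      eₗ = edge (vertex (next j) , l)

      choose : color c eₗ ≡ color c (adjacent (next j)) ⊎ color c eₗ ≡ color c e₀ →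
               OnDart (vertex (next j) , l)
      choose (inj₁ eq) = next j , inj₁ (refl , color-injective c eₗ (adjacent (next j)) eq)
      choose (inj₂ eq) = j , inj₂ (color-injective c eₗ e₀ eq , refl)

    on-saturated : Saturated (fromColoring c) a b OnDart
    on-saturated = record
      { colored   = λ {d} → on-colored (edge d)
      ; at-twin   = λ {d} (i , o) →
          subst (OnCycle graph C _) (cong proj₁ (sym (twin-involutive d))) (i , swap o)
      ; at-vertex = at-vertex
      }
      where
      at-vertex : ∀ {v k} l → OnDart (v , k) → color c (edge (v , l)) ∈[ a , b ] → OnDart (v , l)
      at-vertex l (i , inj₁ (refl , _)) = on-vertex i l
      at-vertex l (i , inj₂ (_ , refl)) = on-vertex (next i) l

  module _ (connected : ∀ γ → KempeConnected γ) where

    -- The darts of the cycle form a nonempty saturated set, so by connectivity they include all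
    -- those colored `a` or `b`. The switch is therefore a global transposition of labels.
    switch⇒≈ : ∀ {c d} → Switch graph c d → c ≈ᵍ d
    switch⇒≈ {c} {d} s e f = mk⇔
      (λ eq → trans (relabeled e) (trans (cong (transpose a b) eq) (sym (relabeled f))))
      (λ eq → transpose-injective a b (trans (sym (relabeled e)) (trans eq (relabeled f))))
      where
      open Switch s
      open Cycle C

      on-all : ∀ {u v} (e : Adj u v) → color c e ∈[ a , b ] → OnCycle graph C u v
      on-all (k , refl) = connected (fromColoring c) a≢b (on-saturated c C isKempe)
        {dart (adjacent zero)} (zero , inj₁ (refl , proj₂ (adjacent zero)))

      relabeled : ∀ {u v} (e : Adj u v) → color d e ≡ transpose a b (color c e)
      relabeled e with (color c e ≟ a) ⊎-dec (color c e ≟ b)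
      ... | yes e∈ = on e (on-all e e∈)
      ... | no  e∉ = trans (off e (e∉ ∘ on-colored c C isKempe e)) (sym (transpose-fixes e∉))

    ∼⇒≈ : ∀ {c d} → c ∼ᵍ d → c ≈ᵍ d
    ∼⇒≈ ε            e f = Equiv.refl
    ∼⇒≈ (inj₁ p ◅ r) e f = Equiv.trans (p e f) (∼⇒≈ r e f)
    ∼⇒≈ (inj₂ s ◅ r) e f = Equiv.trans (switch⇒≈ s e f) (∼⇒≈ r e f)

    ∼⇒same-color : ∀ {γ δ} → toColoring γ ∼ᵍ toColoring δ →
                   ∀ d d′ → col γ d ≡ col γ d′ → col δ d ≡ col δ d′
    ∼⇒same-color r d d′ = Equivalence.to (∼⇒≈ r (edge d) (edge d′))

-- Permutations of three colors

-- Pigeonhole: if `y` were missed, `punchOut` at `y` would inject `Fin (suc n)` into `Fin n`.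
injective⇒surjective : ∀ {n} {f : Fin n → Fin n} → Injective _≡_ _≡_ f → ∀ y → ∃[ x ] f x ≡ y
injective⇒surjective {suc n} {f} inj y with any? (λ x → f x ≟ y)
... | yes p = p
... | no ¬p = contradiction
  (injective⇒≤ {f = punchOut ∘ missed} (inj ∘ punchOut-injective (missed _) (missed _)))
  1+n≰n
  where
  missed : ∀ x → y ≢ f x
  missed x y≡fx = ¬p (x , sym y≡fx)

∉-unique : ∀ {a b x y} → a ≢ b → ¬ x ∈[ a , b ] → ¬ y ∈[ a , b ] → x ≡ y
∉-unique {a} {b} {x} {y} = from-yes
  (all? λ (a : Fin 3) → all? λ b → all? λ x → all? λ y →
    ¬? (a ≟ b) →-dec ¬? (x ≟ a ⊎-dec x ≟ b) →-dec ¬? (y ≟ a ⊎-dec y ≟ b) →-dec x ≟ y)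
  a b x y

-- turn s 0F is the identity, and turn s 1F, turn s 2F are the two cyclic
-- shifts, in the order given by the sign s.
turn : Fin 2 → Fin 3 → Fin 3 → Fin 3
turn s k j = (toℕ j + suc (toℕ s) * toℕ k) mod 3

turn-zero : ∀ s j → turn s 0F j ≡ j
turn-zero = from-yes (all? λ s → all? λ j → turn s 0F j ≟ j)

turn-injective : ∀ s k {i j} → turn s k i ≡ turn s k j → i ≡ j
turn-injective s k {i} {j} = from-yes
  (all? λ s → all? λ k → all? λ i → all? λ j → (turn s k i ≟ turn s k j) →-dec i ≟ j) s k i j

turn-free : ∀ s j {k l} → turn s k j ≡ turn s l j → k ≡ l
turn-free s j {k} {l} = from-yes
  (all? λ s → all? λ j → all? λ k → all? λ l → (turn s k j ≟ turn s l j) →-dec k ≟ l) s j k l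

turn-sign : ∀ {s t} j → turn s 1F j ≡ turn t 1F j → s ≡ t
turn-sign {s} {t} j = from-yes
  (all? λ s → all? λ t → all? λ j → (turn s 1F j ≟ turn t 1F j) →-dec s ≟ t) s t j

turn-two : ∀ s j {x} → x ≢ j → x ≢ turn s 1F j → x ≡ turn s 2F j
turn-two s j {x} = from-yes
  (all? λ s → all? λ j → all? λ x →
    ¬? (x ≟ j) →-dec ¬? (x ≟ turn s 1F j) →-dec (x ≟ turn s 2F j))
  s j x

-- The only derangements of three elements are the two 3-cycles, found by a search over the values
-- of `f`.
derangement⇒turn : ∀ {f : Fin 3 → Fin 3} → Injective _≡_ _≡_ f → (∀ j → f j ≢ j) →
                   ∃[ s ] ∀ j → f j ≡ turn s 1F j
derangement⇒turn {f} inj f≢ with s , p , q , r ← from-yes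
  (all? λ (x : Fin 3) → all? λ y → all? λ z →
    ¬? (x ≟ 0F) →-dec ¬? (y ≟ 1F) →-dec ¬? (z ≟ 2F) →-dec
    ¬? (x ≟ y) →-dec ¬? (x ≟ z) →-dec ¬? (y ≟ z) →-dec
    any? λ s → (x ≟ turn s 1F 0F) ×-dec (y ≟ turn s 1F 1F) ×-dec (z ≟ turn s 1F 2F))
  (f 0F) (f 1F) (f 2F) (f≢ 0F) (f≢ 1F) (f≢ 2F)
  (0≢1+n ∘ inj) (0≢1+n ∘ inj) (0≢1+n ∘ suc-injective ∘ inj)
  = s , λ { 0F → p ; 1F → q ; 2F → r }

-- f j k is the color at the site of rail j in a fixed level: to the left for
-- k = 0F, on the spoke for k = 1F and to the right for k = 2F.
record Level (f : Fin 3 → Fin 3 → Fin 3) : Set where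
  field
    rail-injective  : Injective _≡_ _≡_ (λ j → f j 0F)
    spoke-injective : Injective _≡_ _≡_ (λ j → f j 1F)
    port-injective  : ∀ j → Injective _≡_ _≡_ (f j)

-- Rails and spokes each show all three colors, so every spoke takes its color from some rail on the
-- left. This permutation has no fixed point, as the colors at a site differ, so it is a cyclic
-- shift; the remaining color at each site comes from the other shift.
level-sign : ∀ {f} → Level f → ∃[ s ] ∀ j k → f j k ≡ f (turn s k j) 0F
level-sign {f} level = s , turned
  where
  open Level level

  source : Fin 3 → Fin 3 → Fin 3
  source j k = proj₁ (injective⇒surjective rail-injective (f j k))

  f-source : ∀ j k → f (source j k) 0F ≡ f j k
  f-source j k = proj₂ (injective⇒surjective rail-injective (f j k))

  source-injective : ∀ j {k l} → source j k ≡ source j l → k ≡ l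
  source-injective j {k} {l} eq = port-injective j
    (trans (sym (f-source j k)) (trans (cong (λ i → f i 0F) eq) (f-source j l)))

  source-zero : ∀ j → source j 0F ≡ j
  source-zero j = rail-injective (f-source j 0F)

  source≢ : ∀ j k → source j (suc k) ≢ j
  source≢ j k eq with () ← source-injective j (trans eq (sym (source-zero j)))

  spoke-source : ∃[ s ] ∀ j → source j 1F ≡ turn s 1F j
  spoke-source = derangement⇒turn
    (λ {i} {j} eq → spoke-injective
      (trans (sym (f-source i 1F)) (trans (cong (λ i → f i 0F) eq) (f-source j 1F))))
    (λ j → source≢ j 0F)

  s : Fin 2
  s = proj₁ spoke-source

  source-turn : ∀ j k → source j k ≡ turn s k j
  source-turn j 0F = trans (source-zero j) (sym (turn-zero s j))
  source-turn j 1F = proj₂ spoke-source j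
  source-turn j 2F = turn-two s j (source≢ j 1F) λ eq →
    contradiction (source-injective j (trans eq (sym (proj₂ spoke-source j)))) λ ()

  turned : ∀ j k → f j k ≡ f (turn s k j) 0F
  turned j k = trans (sym (f-source j k)) (cong (λ i → f i 0F) (source-turn j k))

-- The ladder graph

data Vertex (n : ℕ) : Set where
  left right : Vertex n
  apex       : Fin n → Vertex n
  site       : Fin n → Fin 3 → Vertex n

vertices : ∀ {n} → Vertex n ↔ Fin (4 * n + 2)
vertices {n} = ↔-trans
  (mk↔ₛ′ to from
    (λ { (inj₁ (0F , _)) → refl ; (inj₁ (suc _ , _)) → refl ; (inj₂ 0F) → refl ; (inj₂ 1F) → refl })
    (λ { left → refl ; right → refl ; (apex _) → refl ; (site _ _) → refl }))
  (↔-trans (↔-sym *↔× ⊎-↔ ↔-refl) (↔-sym +↔⊎))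
  where
  to : Vertex n → (Fin 4 × Fin n) ⊎ Fin 2
  to left       = inj₂ 0F
  to right      = inj₂ 1F
  to (apex i)   = inj₁ (0F , i)
  to (site i j) = inj₁ (suc j , i)
  from : (Fin 4 × Fin n) ⊎ Fin 2 → Vertex n
  from (inj₁ (0F , i))    = apex i
  from (inj₁ (suc j , i)) = site i j
  from (inj₂ 0F)          = left
  from (inj₂ 1F)          = right

-- Rail j has segments 0 , … , n, and railˡ i j and railʳ i j are the darts at
-- the left and right end of segment i.
railˡ : ∀ {n} → Fin (suc n) → Fin 3 → Vertex n × Fin 3
railˡ zero    j = left , j
railˡ (suc i) j = site i j , 2F

railʳ : ∀ {n} → Fin (suc n) → Fin 3 → Vertex n × Fin 3
railʳ i j with view i
... | ‵fromℕ     = right , j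
... | ‵inject₁ i = site i j , 0F

railʳ-inject₁ : ∀ {n} (i : Fin n) j → railʳ (inject₁ i) j ≡ (site i j , 0F)
railʳ-inject₁ i j rewrite view-inject₁ i = refl

railʳ-fromℕ : ∀ n j → railʳ (fromℕ n) j ≡ (right , j)
railʳ-fromℕ n j rewrite view-fromℕ n = refl

twin : ∀ {n} → Vertex n × Fin 3 → Vertex n × Fin 3
twin (left     , j)  = railʳ zero j
twin (right    , j)  = railˡ (fromℕ _) j
twin (apex i   , j)  = site i j , 1F
twin (site i j , 0F) = railˡ (inject₁ i) j
twin (site i j , 1F) = apex i , j
twin (site i j , 2F) = railʳ (suc i) j

twin-railˡ : ∀ {n} (i : Fin (suc n)) j → twin (railˡ i j) ≡ railʳ i j
twin-railˡ zero    j = refl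
twin-railˡ (suc i) j = refl

twin-railʳ : ∀ {n} (i : Fin (suc n)) j → twin (railʳ i j) ≡ railˡ i j
twin-railʳ i j with view i
... | ‵fromℕ     = refl
... | ‵inject₁ i = refl

twin-involutive : ∀ {n} (d : Vertex n × Fin 3) → twin (twin d) ≡ d
twin-involutive (left     , j)  = twin-railʳ zero j
twin-involutive (right    , j)  = trans (twin-railˡ (fromℕ _) j) (railʳ-fromℕ _ j)
twin-involutive (apex i   , j)  = refl
twin-involutive (site i j , 0F) = trans (twin-railˡ (inject₁ i) j) (railʳ-inject₁ i j)
twin-involutive (site i j , 1F) = refl
twin-involutive (site i j , 2F) = twin-railʳ (suc i) j

-- An apex is placed at its own level, so that the three neighbours of a site
-- have different positions.
position : ∀ {n} → Vertex n → ℕ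
position     left       = 0
position {n} right      = suc n
position     (apex i)   = suc (toℕ i)
position     (site i j) = suc (toℕ i)

position-railˡ : ∀ {n} (i : Fin (suc n)) j → position (proj₁ (railˡ i j)) ≡ toℕ i
position-railˡ zero    j = refl
position-railˡ (suc i) j = refl

position-railʳ : ∀ {n} (i : Fin (suc n)) j → position (proj₁ (railʳ i j)) ≡ suc (toℕ i)
position-railʳ i j with view i
... | ‵fromℕ     = cong suc (sym (toℕ-fromℕ _))
... | ‵inject₁ i = cong suc (sym (toℕ-inject₁ i))

position-neighbour : ∀ {n} (i : Fin n) j k →
                     position (proj₁ (twin (site i j , k))) ≡ toℕ k + toℕ i
position-neighbour i j 0F = trans (position-railˡ (inject₁ i) j) (toℕ-inject₁ i)
position-neighbour i j 1F = refl
position-neighbour i j 2F = position-railʳ (suc i) j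

-- With no level, `left` and `right` would be joined by three parallel edges. Otherwise `left`,
-- `right` and each apex see sites on distinct rails, and the neighbours of a site are told apart by
-- position.
simple : ∀ {m} {v : Vertex (suc m)} {k l} →
         proj₁ (twin (v , k)) ≡ proj₁ (twin (v , l)) → k ≡ l
simple {v = left}            refl = refl
simple {v = right}           refl = refl
simple {v = apex i}          refl = refl
simple {v = site i j} {k} {l} eq  = toℕ-injective (+-cancelʳ-≡ (toℕ i) (toℕ k) (toℕ l)
  (trans (sym (position-neighbour i j k)) (trans (cong position eq) (position-neighbour i j l))))

even : ℕ → Bool
even zero    = true
even (suc n) = not (even n)

-- An apex needs the parity opposite to that of its sites, so it cannot use its own `position`.
side : ∀ {n} → Vertex n → Bool
side (apex i) = even (toℕ i)
side v        = even (position v)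

side-railˡ : ∀ {n} (i : Fin (suc n)) j → side (proj₁ (railˡ i j)) ≡ even (toℕ i)
side-railˡ zero    j = refl
side-railˡ (suc i) j = refl

side-railʳ : ∀ {n} (i : Fin (suc n)) j → side (proj₁ (railʳ i j)) ≡ not (even (toℕ i))
side-railʳ {n} i j with view i
... | ‵fromℕ     = cong (not ∘ even) (sym (toℕ-fromℕ n))
... | ‵inject₁ i = cong (not ∘ even) (sym (toℕ-inject₁ i))

side-twin : ∀ {n} (d : Vertex n × Fin 3) → side (proj₁ (twin d)) ≡ not (side (proj₁ d))
side-twin {n} (left  , j) = side-railʳ {n} zero j
side-twin {n} (right , j) = trans (side-railˡ (fromℕ n) j)
  (trans (cong even (toℕ-fromℕ n)) (sym (not-involutive (even n))))
side-twin (apex i   , j)  = refl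
side-twin (site i j , 0F) = trans (side-railˡ (inject₁ i) j)
  (trans (cong even (toℕ-inject₁ i)) (sym (not-involutive _)))
side-twin (site i j , 1F) = sym (not-involutive _)
side-twin (site i j , 2F) = side-railʳ (suc i) j

ladder : ℕ → DartSystem
ladder m = record
  { V               = Vertex (suc m)
  -- The field `order` is inferred from here as `4 * suc m + 2`.
  ; enumeration     = vertices
  ; twin            = twin
  ; twin-involutive = twin-involutive
  ; simple          = λ {v} → simple {v = v}
  ; side            = side
  ; side-twin       = side-twin
  }

-- The standard coloring of a sign vector

-- The colors on segment i of the rails, when they are 0F, 1F, 2F at left.
shift : ∀ {n} → (Fin n → Fin 2) → Fin (suc n) → Fin 3 → Fin 3
shift         s zero    j = j
shift {suc n} s (suc i) j = turn (s zero) 2F (shift (s ∘ suc) i j)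

-- The definition splits off the first level, while induction along the rails needs the last one
-- split off.
shift-suc : ∀ {n} (s : Fin n → Fin 2) i j →
            shift s (suc i) j ≡ shift s (inject₁ i) (turn (s i) 2F j)
shift-suc s zero    j = refl
shift-suc s (suc i) j = cong (turn (s zero) 2F) (shift-suc (s ∘ suc) i j)

shift-injective : ∀ {n} (s : Fin n → Fin 2) i → Injective _≡_ _≡_ (shift s i)
shift-injective         s zero    eq = eq
shift-injective {suc n} s (suc i) eq = shift-injective (s ∘ suc) i (turn-injective (s zero) 2F eq)

-- These are the colors that `level-sign` forces once each dart at `left` is colored by its own
-- index.
shiftColor : ∀ {n} → (Fin n → Fin 2) → Vertex n × Fin 3 → Fin 3
shiftColor s (left     , j) = j
shiftColor s (right    , j) = shift s (fromℕ _) j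
shiftColor s (apex i   , j) = shift s (inject₁ i) (turn (s i) 1F j)
shiftColor s (site i j , k) = shift s (inject₁ i) (turn (s i) k j)

shiftColor-railˡ : ∀ {n} (s : Fin n → Fin 2) i j → shiftColor s (railˡ i j) ≡ shift s i j
shiftColor-railˡ s zero    j = refl
shiftColor-railˡ s (suc i) j = sym (shift-suc s i j)

shiftColor-railʳ : ∀ {n} (s : Fin n → Fin 2) i j → shiftColor s (railʳ i j) ≡ shift s i j
shiftColor-railʳ s i j with view i
... | ‵fromℕ     = refl
... | ‵inject₁ i = cong (shift s (inject₁ i)) (turn-zero (s i) j)

shiftColor-twin : ∀ {n} (s : Fin n → Fin 2) d → shiftColor s (twin d) ≡ shiftColor s d
shiftColor-twin s (left     , j)  = shiftColor-railʳ s zero j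
shiftColor-twin s (right    , j)  = shiftColor-railˡ s (fromℕ _) j
shiftColor-twin s (apex i   , j)  = refl
shiftColor-twin s (site i j , 0F) = trans (shiftColor-railˡ s (inject₁ i) j)
  (sym (cong (shift s (inject₁ i)) (turn-zero (s i) j)))
shiftColor-twin s (site i j , 1F) = refl
shiftColor-twin s (site i j , 2F) = trans (shiftColor-railʳ s (suc i) j) (shift-suc s i j)

shiftColor-injective : ∀ {n} (s : Fin n → Fin 2) {v k l} →
                       shiftColor s (v , k) ≡ shiftColor s (v , l) → k ≡ l
shiftColor-injective s {left}     eq = eq
shiftColor-injective s {right}    eq = shift-injective s (fromℕ _) eq
shiftColor-injective s {apex i}   eq = turn-injective (s i) 1F (shift-injective s (inject₁ i) eq)
shiftColor-injective s {site i j} eq = turn-free (s i) j (shift-injective s (inject₁ i) eq)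

-- The rails left of level `i` carry the same colors for `s` and `t`, so `shift` cancels from the
-- color of a spoke; a single value of `turn` then reveals the sign.
shiftColor-sign : ∀ {n} {s t : Fin n → Fin 2} →
                  (∀ d → shiftColor s d ≡ shiftColor t d) → ∀ i → s i ≡ t i
shiftColor-sign {s = s} {t} eq i = turn-sign 0F (shift-injective t (inject₁ i)
  (trans (sym (shift-agree (turn (s i) 1F 0F))) (eq (apex i , 0F))))
  where
  shift-agree : ∀ j → shift s (inject₁ i) j ≡ shift t (inject₁ i) j
  shift-agree j = trans (sym (shiftColor-railˡ s (inject₁ i) j))
    (trans (eq (railˡ (inject₁ i) j)) (shiftColor-railˡ t (inject₁ i) j))

funToFin-cong : ∀ {m n} {f g : Fin m → Fin n} → (∀ i → f i ≡ g i) → funToFin f ≡ funToFin g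
funToFin-cong {zero}  eq = refl
funToFin-cong {suc m} eq = cong₂ combine (eq zero) (funToFin-cong (eq ∘ suc))

-- Signs and Kempe connectivity on the ladder

module _ {m : ℕ} where
  open DartSystem (ladder m)
    using ( Dart; edge; graph; DartColoring; module DartColoring; toColoring; fromColoring
          ; recolored⇒≈; _≈ᵍ_; _∼ᵍ_; ∼⇒same-color; Saturated; module Saturated; KempeConnected)

  module _ (γ : DartColoring) where
    open DartColoring γ

    col-rail : ∀ i j → col (site i j , 0F) ≡ col (railˡ (inject₁ i) j)
    col-rail i j = sym (col-twin (site i j , 0F))

    col-spoke : ∀ i j → col (site i j , 1F) ≡ col (apex i , j)
    col-spoke i j = sym (col-twin (site i j , 1F))

    level : ∀ i → Injective _≡_ _≡_ (λ j → col (railˡ (inject₁ i) j)) →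
            Level (λ j k → col (site i j , k))
    level i inj = record
      { rail-injective  = λ eq → inj (trans (sym (col-rail i _)) (trans eq (col-rail i _)))
      ; spoke-injective = λ eq →
          col-injective (trans (sym (col-spoke i _)) (trans eq (col-spoke i _)))
      ; port-injective  = λ _ → col-injective
      }

    -- Crossing a level only permutes the rail colors, so the rails keep the three different colors
    -- they have at `left`. Hence every level has a sign.
    rails-injective : ∀ i → Injective _≡_ _≡_ (λ j → col (railˡ i j))
    rails-injective = <-weakInduction _ col-injective λ i inj {j} {k} eq →
      let ℓ        = level i inj
          s , turned = level-sign ℓ
      in turn-injective s 2F (Level.rail-injective ℓ
           (trans (sym (turned j 2F)) (trans eq (turned k 2F))))

    sign : Fin (suc m) → Fin 2
    sign i = proj₁ (level-sign (level i (rails-injective (inject₁ i))))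

    turned : ∀ i j k → col (site i j , k) ≡ col (railˡ (inject₁ i) (turn (sign i) k j))
    turned i j k = trans (proj₂ (level-sign (level i (rails-injective (inject₁ i)))) j k)
                         (col-rail i _)

  -- Every dart colored `a` or `b` is shown to be in `P` exactly when the dart colored `a` at `left`
  -- is. Membership thus passes from `d₀` to that dart and on to any other.
  connected : ∀ γ → KempeConnected γ
  connected γ {a} {b} {P} a≢b saturated {d₀} Pd₀ d∈ =
    Equivalence.from (linked _ d∈) (Equivalence.to (linked d₀ (colored Pd₀)) Pd₀)
    where
    open DartColoring γ
    open Saturated saturated

    at-twin⇔ : ∀ d → P d ⇔ P (twin d)
    at-twin⇔ d = mk⇔ at-twin (subst P (twin-involutive d) ∘ at-twin)

    at-vertex⇔ : ∀ {v} k l → col (v , k) ∈[ a , b ] → col (v , l) ∈[ a , b ] → P (v , k) ⇔ P (v , l)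
    at-vertex⇔ k l k∈ l∈ = mk⇔ (λ p → at-vertex l p l∈) (λ p → at-vertex k p k∈)

    _∈? : ∀ x → Dec (x ∈[ a , b ])
    x ∈? = x ≟ a ⊎-dec x ≟ b

    j₀ : Fin 3
    j₀ = proj₁ (injective⇒surjective (col-injective {left}) a)

    j₀∈ : col (left , j₀) ∈[ a , b ]
    j₀∈ = inj₁ (proj₂ (injective⇒surjective (col-injective {left}) a))

    Linked : Dart → Set
    Linked d = col d ∈[ a , b ] → P d ⇔ P (left , j₀)

    link : ∀ {d d′} → P d ⇔ P d′ → col d′ ∈[ a , b ] → Linked d′ → Linked d
    link eq d′∈ ℓ _ = Equiv.trans eq (ℓ d′∈)

    link-twin : ∀ d → Linked (twin d) → Linked d
    link-twin d ℓ d∈ = link (at-twin⇔ d) (subst (_∈[ a , b ]) (sym (col-twin d)) d∈) ℓ d∈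

    link-vertex : ∀ {v} k l → col (v , k) ∈[ a , b ] → Linked (v , k) → Linked (v , l)
    link-vertex k l k∈ ℓ l∈ = link (at-vertex⇔ l k l∈ k∈) k∈ ℓ l∈

    others : ∀ {v} k l → ¬ col (v , k) ∈[ a , b ] → k ≢ l → col (v , l) ∈[ a , b ]
    others {v} k l k∉ k≢l with col (v , l) ∈?
    ... | yes l∈ = l∈
    ... | no  l∉ = contradiction (col-injective (∉-unique a≢b k∉ l∉)) k≢l

    -- If the rail at j is not colored a or b, its site is reached through the
    -- apex, since its spoke and one of the other two are colored a or b.
    site-linked : ∀ i → (∀ j → Linked (railˡ (inject₁ i) j)) → ∀ j k → Linked (site i j , k)
    site-linked i rails j k with col (site i j , 0F) ∈?
    ... | yes j∈ = link-vertex 0F k j∈ (link-twin (site i j , 0F) (rails j))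
    ... | no  j∉ = link-vertex 1F k spoke∈ (link-twin (site i j , 1F) via-apex)
      where
      spoke∈ : col (site i j , 1F) ∈[ a , b ]
      spoke∈ = others 0F 1F j∉ λ ()

      -- The rails of a level have different colors, so at most one avoids both `a` and `b`.
      rail∈ : ∀ {j′} → j′ ≢ j → col (site i j′ , 0F) ∈[ a , b ]
      rail∈ {j′} j′≢j with col (site i j′ , 0F) ∈?
      ... | yes p = p
      ... | no  q = contradiction
        (Level.rail-injective (level γ i (rails-injective γ (inject₁ i))) (∉-unique a≢b q j∉)) j′≢j

      through : ∀ {j′} → j′ ≢ j → col (apex i , j′) ∈[ a , b ] → Linked (apex i , j)
      through {j′} j′≢j p = link-vertex j′ j p (link-twin (apex i , j′)
        (link-vertex 0F 1F (rail∈ j′≢j) (link-twin (site i j′ , 0F) (rails j′))))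

      via-apex : Linked (apex i , j)
      via-apex with col (apex i , punchIn j 0F) ∈?
      ... | yes p = through (punchInᵢ≢i j 0F) p
      ... | no  q = through (punchInᵢ≢i j 1F)
        (others (punchIn j 0F) (punchIn j 1F) q (λ eq → 0≢1+n (punchIn-injective j 0F 1F eq)))

    rail-linked : ∀ i j → Linked (railˡ i j)
    rail-linked = <-weakInduction _
      (λ j → link-vertex j₀ j j₀∈ (λ _ → Equiv.refl))
      (λ i rails j → site-linked i rails j 2F)

    linked : ∀ d → Linked d
    linked (left     , j) = rail-linked zero j
    linked (right    , j) = link-twin (right , j) (rail-linked (fromℕ _) j)
    linked (site i j , k) = site-linked i (rail-linked (inject₁ i)) j k
    linked (apex i   , j) = link-twin (apex i , j) (linked (site i j , 1F))

  -- Normal forms and the count of classes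

  shiftColoring : (Fin (suc m) → Fin 2) → DartColoring
  shiftColoring s = record
    { col           = shiftColor s
    ; col-twin      = shiftColor-twin s
    ; col-injective = λ {v} → shiftColor-injective s {v}
    }

  -- The colors at `left` serve as the relabeling, and the signs carry them along the rails. The
  -- signs are matched pointwise because decoding an index recovers them only pointwise.
  normal-form : ∀ γ {s} → (∀ i → sign γ i ≡ s i) →
                ∀ d → DartColoring.col γ d ≡ DartColoring.col γ (left , shiftColor s d)
  normal-form γ {s} sign≗s = normal
    where
    open DartColoring γ

    turned′ : ∀ i j k → col (site i j , k) ≡ col (railˡ (inject₁ i) (turn (s i) k j))
    turned′ i j k =
      trans (turned γ i j k) (cong (λ t → col (railˡ (inject₁ i) (turn t k j))) (sign≗s i))

    rails : ∀ i j → col (railˡ i j) ≡ col (left , shift s i j)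
    rails = <-weakInduction _ (λ j → refl) λ i ih j → trans (turned′ i j 2F)
      (trans (ih (turn (s i) 2F j)) (cong (λ k → col (left , k)) (sym (shift-suc s i j))))

    normal : ∀ d → col d ≡ col (left , shiftColor s d)
    normal (left     , j) = refl
    normal (right    , j) = trans (sym (col-twin (right , j))) (rails (fromℕ _) j)
    normal (apex i   , j) = trans (sym (col-spoke γ i j)) (normal (site i j , 1F))
    normal (site i j , k) = trans (turned′ i j k) (rails (inject₁ i) (turn (s i) k j))

  sign≗⇒≈ : ∀ {c s} → (∀ i → sign (fromColoring c) i ≡ s i) → toColoring (shiftColoring s) ≈ᵍ c
  sign≗⇒≈ {c} {s} sign≗s =
    recolored⇒≈ {shiftColoring s} {c} (DartColoring.col-injective γ {left}) (normal-form γ sign≗s)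
    where
    γ : DartColoring
    γ = fromColoring c

  -- Every edge shares its color with an edge at left, whose colors do not depend on the signs.
  ∼⇒≗ : ∀ {s t} → toColoring (shiftColoring s) ∼ᵍ toColoring (shiftColoring t) → ∀ i → s i ≡ t i
  ∼⇒≗ {s} {t} r = shiftColor-sign λ d → sym
    (∼⇒same-color connected {shiftColoring s} {shiftColoring t} r d (left , shiftColor s d) refl)

  classes : HasKempeClasses graph (2 ^ suc m)
  classes = record
    { to        = coloring
    ; cong      = λ { refl → ε }
    -- One relabeling step leads from a standard coloring to `c`; no Kempe switch occurs.
    ; bijective = injective , λ c → index c , λ { refl → inj₁ (surjective c) ◅ ε }
    }
    where
    coloring : Fin (2 ^ suc m) → Coloring graph
    coloring x = toColoring (shiftColoring (finToFun x))

    injective : ∀ {x y} → coloring x ∼ᵍ coloring y → x ≡ y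
    injective {x} {y} r = trans (sym (funToFin-finToFin {suc m} {2} x))
      (trans (funToFin-cong (∼⇒≗ {finToFun x} {finToFun y} r)) (funToFin-finToFin {suc m} {2} y))

    index : Coloring graph → Fin (2 ^ suc m)
    index c = funToFin (sign (fromColoring c))

    surjective : ∀ c → coloring (index c) ≈ᵍ c
    surjective c = sign≗⇒≈ {c} (λ i → sym (finToFun-funToFin (sign (fromColoring c)) i))

theorem5 : (n : ℕ) → n ≥ 1 →
    Σ[ G ∈ Graph ]
    (Graph.order G ≡ 4 * n + 2 × Cubic G × Bipartite G × HasKempeClasses G (2 ^ n))
theorem5 (suc m) _ = graph , refl , cubic , bipartite , classes
  where open DartSystem (ladder m)
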